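{- Let $n\ge1$ and let $T\in \mathrm{T}_{n-1}$. The order $(\mathfrak S_n,\le_T)$ is a refinement of the right weak order and a coarsening of the Bruhat order, i.e. for all $v,w\in\mathfrak S_n$, $$v\le_R w\implies v\le_T w\implies v\le w,$$ where $\le_R$ is the right weak order and $\le$ is the Bruhat order on $\mathfrak S_n$.
   Context: Permutations $w\in\mathfrak S_n$ are written as words $w=w_1\cdots w_n$. The inversion set of $w$ is the set of pairs of values $(i,j)$, $1\le i<j\le n$, such that $j$ appears before $i$ in $w$. The right weak order is: $v\le_R w$ iff the inversion set of $v$ is contained in that of $w$ (covers exchange the values in two adjacent positions). The Bruhat order $\le$ is the usual one. The poset $\mathcal P_n$ is the set of pairs of integers $(i,j)$ with $1\le i<j\le n$, ordered by $(i_1,j_1)\le(i_2,j_2)$ iff $i_2\le i_1$ and $j_1\le j_2$. For $\sigma=\sigma_1\cdots\sigma_{n-1}\in\mathfrak S_{n-1}$ and $1\le k\le n-1$ let $$\mathcal R_{\sigma,k}=\{x\in\mathcal P_n:\ (k,k+1)\le x\ \text{and}\ (\sigma_\ell,\sigma_\ell+1)\not\le x\ \text{for all}\ \ell<\sigma^{ -1}(k)\}.$$ These sets partition $\mathcal P_n$; each gets the order induced from $\mathcal P_n$, and $\mathcal R_\sigma$ is the disjoint union of the posets $\mathcal R_{\sigma,k}$. $\mathrm T_{n-1}$ is the set of binary trees with internal nodes labelled $1,\dots,n-1$ in in-order. The binary search tree of $\sigma$ has root $\sigma_1$, and its left (resp. right) subtree is the binary search tree of the subword of $\sigma$ of values smaller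 (resp. greater) than $\sigma_1$. Every $T\in \mathrm T_{n-1}$ is the binary search tree of some $\sigma\in\mathfrak S_{n-1}$, and $\mathcal R_\sigma$, $\mathcal R_{\sigma,k}$ depend only on $T$; they are written $\mathcal R_T$, $\mathcal R_{T,k}$. Let $(i_{T,k},j_{T,k})$ be the maximum of $\mathcal R_{T,k}$. For $w\in\mathfrak S_n$ let $w^{L,k}$ (resp. $w^{R,k}$) be the subword of $w$ of values in $[i_{T,k},k]$ (resp. in $[k+1,j_{T,k}]$). Then $I_T(w)\subset\mathcal R_T$ is the set such that, for all $1\le k\le n-1$, $i_{T,k}\le i\le k$, $k+1\le j\le j_{T,k}$: $(i,j)\in I_T(w)$ iff the value $w^{L,k}_{i-i_{T,k}+1}$ appears after the value $w^{R,k}_{j-k}$ in $w$. The partial order $\le_T$ on $\mathfrak S_n$ is $v\le_T w$ iff $I_T(v)\subset I_T(w)$. -}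

module Defs where

open import Data.Fin.Base as Fin using (Fin; toℕ)
open import Data.Fin.Permutation
  using (Permutation′; _⟨$⟩ʳ_; _⟨$⟩ˡ_; _≈_; _∘ₚ_; transpose)
open import Data.List.Base using (List; []; _∷_; length; lookup; filter; tabulate; applyUpTo)
open import Data.Nat.Base using (ℕ; suc; _+_; _∸_; _≤_; _<_)
open import Data.Nat.Properties using (_≤?_; _<?_)
open import Data.Product.Base using (Σ-syntax; ∃-syntax; _×_; _,_; proj₁)
open import Data.Tree.Binary using (Tree; leaf; node; module Infix)
open import Data.Unit.Base using (⊤; tt)
open import Level using (0ℓ)
open import Relation.Binary.Construct.Closure.ReflexiveTransitive using (Star)
open import Relation.Binary.Construct.Union using (_∪_)
open import Relation.Binary.Core using (Rel)
open import Relation.Binary.PropositionalEquality.Core using (_≡_)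
open import Relation.Nullary.Decidable.Core using (_×-dec_)
open import Relation.Nullary.Negation.Core using (¬_)
open import Relation.Unary using (Pred; _∈_; _⊆_)

-- Letters, tree labels and the entries of pairs are the 1-based numbers of the
-- mathematical notation, kept in ℕ; only positions in a word, and the index k
-- of a node, are elements of Fin, and ⟦_⟧ shifts these to 1-based numbers.

⟦_⟧ : ∀ {n} → Fin n → ℕ
⟦ p ⟧ = suc (toℕ p)

𝔖 : ℕ → Set
𝔖 n = Permutation′ n

-- letter w p = w_p
letter : ∀ {n} → 𝔖 n → Fin n → ℕ
letter w p = ⟦ w ⟨$⟩ʳ p ⟧

word : ∀ {n} → 𝔖 n → List ℕ
word w = tabulate (letter w)

Precedes : ∀ {n} → 𝔖 n → ℕ → ℕ → Set
Precedes w a b = ∃[ p ] ∃[ q ] (p Fin.< q × letter w p ≡ a × letter w q ≡ b)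

Pair : Set
Pair = ℕ × ℕ

𝒫 : ℕ → Pred Pair 0ℓ
𝒫 n (i , j) = 1 ≤ i × i < j × j ≤ n

infix 4 _⊑_
_⊑_ : Rel Pair 0ℓ
(i₁ , j₁) ⊑ (i₂ , j₂) = i₂ ≤ i₁ × j₁ ≤ j₂

IsMaximum : Pred Pair 0ℓ → Pair → Set
IsMaximum S x = x ∈ S × (∀ y → y ∈ S → y ⊑ x)

Inv : ∀ {n} → 𝔖 n → Pred Pair 0ℓ
Inv {n} w (i , j) = (i , j) ∈ 𝒫 n × Precedes w j i

infix 4 _≤R_
_≤R_ : ∀ {n} → Rel (𝔖 n) 0ℓ
v ≤R w = Inv v ⊆ Inv w

-- u ⟶ w: w arises from u by exchanging the letters in two positions p < q with
-- u_p < u_q, i.e. w = u t for a transposition t that increases the number of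
-- inversions.  (_∘ₚ_ composes in diagrammatic order.)
infix 4 _⟶_
_⟶_ : ∀ {n} → Rel (𝔖 n) 0ℓ
u ⟶ w = ∃[ p ] ∃[ q ] (p Fin.< q × letter u p < letter u q × w ≈ transpose p q ∘ₚ u)

-- _≈_ (pointwise equality) is included because equal permutations need not be
-- propositionally equal as elements of 𝔖 n.
infix 4 _≤B_
_≤B_ : ∀ {n} → Rel (𝔖 n) 0ℓ
_≤B_ = Star (_≈_ ∪ _⟶_)

𝕋 : ℕ → Set
𝕋 m = Σ[ t ∈ Tree ℕ ⊤ ] Infix.toList t ≡ applyUpTo suc m

-- The graph of the function sending a word to its binary search tree.
data IsBST : List ℕ → Tree ℕ ⊤ → Set where
  leaf : IsBST [] (leaf tt)
  node : ∀ {x xs l r} →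
         IsBST (filter (_<? x) xs) l →
         IsBST (filter (x <?_) xs) r →
         IsBST (x ∷ xs) (node l x r)

-- Below m = n - 1: σ lies in 𝔖 m, trees lie in 𝕋 m, and w lies in 𝔖 (suc m).

ℛσ : ∀ {m} → 𝔖 m → Fin m → Pred Pair 0ℓ
ℛσ {m} σ k x =
    x ∈ 𝒫 (suc m)
  × (⟦ k ⟧ , ⟦ k ⟧ + 1) ⊑ x
  × (∀ ℓ → ℓ Fin.< σ ⟨$⟩ˡ k → ¬ ((letter σ ℓ , letter σ ℓ + 1) ⊑ x))

-- ℛσ σ k is the same for every σ whose binary search tree is T, and such a σ
-- exists.
ℛ : ∀ {m} → 𝕋 m → Fin m → Pred Pair 0ℓ
ℛ {m} T k x = Σ[ σ ∈ 𝔖 m ] (IsBST (word σ) (proj₁ T) × x ∈ ℛσ σ k)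

subword : ∀ {n} → 𝔖 n → ℕ → ℕ → List ℕ
subword w a b = filter (λ x → (a ≤? x) ×-dec (x ≤? b)) (word w)

-- xs [ p ]= a: the p-th entry of xs, counted from 1, is a.
infix 4 _[_]=_
_[_]=_ : List ℕ → ℕ → ℕ → Set
xs [ p ]= a = Σ[ q ∈ Fin (length xs) ] (⟦ q ⟧ ≡ p × lookup xs q ≡ a)

-- (iT , jT) is (i_{T,k} , j_{T,k}), and subword w iT k, subword w (k+1) jT are
-- w^{L,k}, w^{R,k}.  The ranges iT ≤ i ≤ k < j ≤ jT for the various k partition
-- the pairs in 𝒫 (suc m), so at most one k can contribute to a given (i , j).
I : ∀ {m} → 𝕋 m → 𝔖 (suc m) → Pred Pair 0ℓ
I T w (i , j) =
  ∃[ k ] ∃[ iT ] ∃[ jT ] ∃[ a ] ∃[ b ]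
    ( IsMaximum (ℛ T k) (iT , jT)
    × (iT ≤ i × i ≤ ⟦ k ⟧)
    × (⟦ k ⟧ + 1 ≤ j × j ≤ jT)
    × subword w iT ⟦ k ⟧ [ i ∸ iT + 1 ]= a
    × subword w (⟦ k ⟧ + 1) jT [ j ∸ ⟦ k ⟧ ]= b
    × Precedes w b a )

infix 4 _≤[_]_
_≤[_]_ : ∀ {m} → 𝔖 (suc m) → 𝕋 m → 𝔖 (suc m) → Set
v ≤[ T ] w = I T v ⊆ I T w

{-# OPTIONS --safe #-}
module Submission where

-- Everything is expressed by counting the letters of prefixes of v and w.
--
-- Weak order implies T-order by the pigeonhole principle: if a pair of entries
-- were compared differently in v and in w, counting would give an inversion of v
-- that is not an inversion of w.
--
-- For the second implication, a node k of T whose subtree shuffles the letters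
-- a, …, b makes the subword of letters a, …, b a shuffle of its small letters
-- a, …, k and its large letters k + 1, …, b.  Inclusion of I_T says that in w the
-- large letters come earlier than in v.  By induction on T, the subword of w
-- then satisfies the tableau criterion against that of v; the criterion for T
-- itself yields a chain of transpositions from v to w.

open import Defs
open import Data.Empty using (⊥)
open import Data.Fin.Base as Fin using (Fin; zero; suc; toℕ; fromℕ<; cast)
open import Data.Fin.Permutation
  using (_⟨$⟩ʳ_; _⟨$⟩ˡ_; inverseʳ; inverseˡ; _∘ₚ_; cast-id; _≈_; transpose; lift₀-transpose)
import Data.Fin.Permutation.Components as Components
open import Data.Fin.Properties as Fin using (toℕ-injective; toℕ<n; toℕ-cast; toℕ-fromℕ<)
open import Data.List.Base using (List; []; _∷_; _++_; length; lookup; filter; tabulate; applyUpTo)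
open import Data.List.Membership.Propositional using (_∉_; find; lose) renaming (_∈_ to _∈ˡ_)
open import Data.List.Membership.Propositional.Properties
  using (∈-++⁺ˡ; ∈-++⁺ʳ; ∈-++⁻; ∈-filter⁺; ∈-filter⁻; ∈-tabulate⁺; ∈-tabulate⁻; ∈-applyUpTo⁺;
         ∈-∃++; ∈-lookup)
open import Data.List.Membership.Propositional.Properties.WithK using (unique∧set⇒bag)
open import Data.List.Properties
open import Data.List.Relation.Binary.BagAndSetEquality using (∼bag⇒↭)
open import Data.List.Relation.Binary.Permutation.Homogeneous using (onIndices)
open import Data.List.Relation.Binary.Permutation.Propositional
  using (_↭_; refl; prep; swap; ↭-sym; ↭-trans; ↭⇒↭ₛ; module PermutationReasoning)
open import Data.List.Relation.Binary.Permutation.Propositional.Properties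
  using (∈-resp-↭; ↭-length; filter-↭; ++⁺ˡ; shift; drop-∷; ↭-empty-inv)
open import Data.List.Relation.Binary.Permutation.Setoid.Properties using (onIndices-lookup)
open import Data.List.Relation.Binary.Subset.Propositional using () renaming (_⊆_ to _⊆ˡ_)
open import Data.List.Relation.Unary.All as All using (All; []; _∷_; all?)
import Data.List.Relation.Unary.All.Properties as All
open import Data.List.Relation.Unary.AllPairs using ([]; _∷_)
open import Data.List.Relation.Unary.Any using (here; there)
open import Data.List.Relation.Unary.Unique.Propositional using (Unique)
import Data.List.Relation.Unary.Unique.Propositional.Properties as Unique
open import Data.Nat.Base using (ℕ; zero; suc; _+_; _∸_; _≤_; _<_; z≤n; s≤s)
open import Data.Nat.Properties
open import Data.List.Membership.DecPropositional _≟_ using (_∈?_)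
open import Data.Product.Base using (_×_; _,_; proj₁; proj₂; ∃-syntax; Σ-syntax)
open import Data.Sum.Base using (_⊎_; inj₁; inj₂; [_,_]′)
open import Data.Tree.Binary using (Tree; leaf; node; module Infix)
open import Data.Unit.Base using (⊤; tt)
open import Function.Base using (_∘_)
open import Function.Bundles using (mk⇔)
open import Level using (0ℓ)
open import Relation.Binary.Construct.Closure.ReflexiveTransitive using (Star; ε; _◅_; gmap)
open import Relation.Binary.Definitions using (tri<; tri≈; tri>)
open import Relation.Binary.PropositionalEquality as ≡
  using (_≡_; _≢_; _≗_; refl; sym; cong; cong₂; subst; subst₂)
open import Relation.Nullary.Decidable using (yes; no; _×-dec_; dec-true; dec-false)
open import Relation.Nullary.Negation using (¬_; contradiction)
open import Relation.Unary using (Pred; Decidable; _∈_)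

private variable
  A : Set
  x y z : A
  xs ys xs′ ys′ ms ss : List A
  a b c k a′ b′ k′ m n : ℕ
  t : Tree ℕ ⊤

-- Prefixes, counting and the order of entries in a list

++-comparable : ∀ (xs xs′ : List A) → xs ++ ys ≡ xs′ ++ ys′ →
  (∃[ zs ] (xs′ ≡ xs ++ zs × ys ≡ zs ++ ys′)) ⊎ (∃[ zs ] (xs ≡ xs′ ++ zs × ys′ ≡ zs ++ ys))
++-comparable []       xs′       eq = inj₁ (xs′ , refl , eq)
++-comparable (x ∷ xs) []        eq = inj₂ (x ∷ xs , refl , sym eq)
++-comparable (x ∷ xs) (y ∷ xs′) eq with ∷-injective eq
... | refl , eq′ with ++-comparable xs xs′ eq′
...   | inj₁ (zs , p , q) = inj₁ (zs , cong (x ∷_) p , q)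
...   | inj₂ (zs , p , q) = inj₂ (zs , cong (x ∷_) p , q)

unique-++-disjoint : ∀ (xs : List A) → Unique (xs ++ ys) → x ∈ˡ xs → x ∉ ys
unique-++-disjoint (x ∷ xs) (x∉ ∷ u) (here refl) x∈ys = All.lookup x∉ (∈-++⁺ʳ xs x∈ys) refl
unique-++-disjoint (x ∷ xs) (_ ∷ u)  (there x∈)  x∈ys = unique-++-disjoint xs u x∈ x∈ys

unique-++⁻ˡ : ∀ (xs : List A) → Unique (xs ++ ys) → Unique xs
unique-++⁻ˡ []       _        = []
unique-++⁻ˡ (x ∷ xs) (x∉ ∷ u) = All.tabulate (λ i → All.lookup x∉ (∈-++⁺ˡ i)) ∷ unique-++⁻ˡ xs u

unique-⊆-length : Unique xs → xs ⊆ˡ ys → length xs ≤ length ys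
unique-⊆-length []       xs⊆ys = z≤n
unique-⊆-length {xs = x ∷ xs} (x∉xs ∷ u) xs⊆ys with ∈-∃++ (xs⊆ys (here refl))
... | as , bs , refl = begin
  suc (length xs)              ≤⟨ s≤s (unique-⊆-length u avoid) ⟩
  suc (length (as ++ bs))      ≡⟨ cong suc (length-++ as) ⟩
  suc (length as + length bs)  ≡⟨ +-suc (length as) (length bs) ⟨
  length as + suc (length bs)  ≡⟨ length-++ as ⟨
  length (as ++ x ∷ bs)        ∎
  where
  open ≤-Reasoning
  avoid : xs ⊆ˡ as ++ bs
  avoid {y} y∈xs with ∈-++⁻ as (xs⊆ys (there y∈xs))
  ... | inj₁ y∈as         = ∈-++⁺ˡ y∈as
  ... | inj₂ (here refl)  = contradiction refl (All.lookup x∉xs y∈xs)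
  ... | inj₂ (there y∈bs) = ∈-++⁺ʳ as y∈bs

pigeonhole : ∀ {xs ys : List ℕ} → Unique xs → length ys < length xs → ∃[ x ] (x ∈ˡ xs × x ∉ ys)
pigeonhole {xs} {ys} u lt with all? (_∈? ys) xs
... | yes all = contradiction (unique-⊆-length u (All.lookup all)) (<⇒≱ lt)
... | no ¬all = find (All.¬All⇒Any¬ (_∈? ys) xs ¬all)

-- A cut of the list stands in for positions. It survives filtering and prepending, and two cuts of
-- one list are always comparable.
Before : A → A → List A → Set
Before x y zs = ∃[ xs ] ∃[ ys ] (zs ≡ xs ++ ys × x ∈ˡ xs × y ∈ˡ ys)

-- Comparing the two cuts shows that one of the letters lies on both sides of the first cut.
before-asym : ∀ {zs : List A} → Unique zs → Before x y zs → ¬ Before y x zs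
before-asym u (xs , ys , refl , x∈xs , y∈ys) (xs′ , ys′ , eq , y∈xs′ , x∈ys′)
  with ++-comparable xs xs′ eq
... | inj₁ (zs , _ , refl) = unique-++-disjoint xs u x∈xs (∈-++⁺ʳ zs x∈ys′)
... | inj₂ (zs , refl , _) = unique-++-disjoint xs u (∈-++⁺ˡ y∈xs′) y∈ys

before-here : y ∈ˡ xs → Before x y (x ∷ xs)
before-here {x = x} y∈ = x ∷ [] , _ , refl , here refl , y∈

before-there : Before x y xs → Before x y (z ∷ xs)
before-there {z = z} (us , vs , refl , x∈ , y∈) = z ∷ us , vs , refl , there x∈ , y∈

before-∷⁻ : Before x y (z ∷ xs) → (x ≡ z × y ∈ˡ xs) ⊎ Before x y xs
before-∷⁻ (_ ∷ us , vs , refl , here refl , y∈) = inj₁ (refl , ∈-++⁺ʳ us y∈)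
before-∷⁻ (_ ∷ us , vs , refl , there x∈ , y∈)  = inj₂ (us , vs , refl , x∈ , y∈)

before⇒∈ʳ : Before x y xs → y ∈ˡ xs
before⇒∈ʳ (us , vs , refl , x∈ , y∈) = ∈-++⁺ʳ us y∈

module _ {P : Pred A 0ℓ} (P? : Decidable P) where

  before-filter⁺ : Before x y xs → P x → P y → Before x y (filter P? xs)
  before-filter⁺ (us , vs , refl , x∈ , y∈) px py =
    filter P? us , filter P? vs , filter-++ P? us vs , ∈-filter⁺ P? x∈ px , ∈-filter⁺ P? y∈ py

  before-filter⁻ : Before x y (filter P? xs) → Before x y xs
  before-filter⁻ {xs = []}     bef = bef
  before-filter⁻ {xs = z ∷ xs} bef with P? z
  ... | no _  = before-there (before-filter⁻ bef)
  ... | yes _ with before-∷⁻ bef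
  ...   | inj₁ (refl , y∈) = before-here (proj₁ (∈-filter⁻ P? y∈))
  ...   | inj₂ bef′        = before-there (before-filter⁻ bef′)

before-tabulate⁺ : ∀ {n} {f : Fin n → A} {p q} → p Fin.< q → Before (f p) (f q) (tabulate f)
before-tabulate⁺ {f = f} {zero}  {suc q} _         = _ ∷ [] , _ , refl , here refl , ∈-tabulate⁺ q
before-tabulate⁺ {f = f} {suc p} {suc q} (s≤s p<q) with before-tabulate⁺ {f = f ∘ suc} p<q
... | xs , ys , eq , x∈ , y∈ = f zero ∷ xs , ys , cong (f zero ∷_) eq , there x∈ , y∈

before-tabulate⁻ : ∀ {n} {f : Fin n → A} → Before x y (tabulate f) →
  ∃[ p ] ∃[ q ] (p Fin.< q × f p ≡ x × f q ≡ y)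
before-tabulate⁻ {n = suc n} (z ∷ xs , ys , eq , x∈ , y∈) with ∷-injective eq | x∈
... | refl , eq′ | here refl with ∈-tabulate⁻ (subst (_ ∈ˡ_) (sym eq′) (∈-++⁺ʳ xs y∈))
...   | q , refl = zero , suc q , s≤s z≤n , refl , refl
before-tabulate⁻ {n = suc n} (z ∷ xs , ys , eq , x∈ , y∈) | refl , eq′ | there x∈′
  with before-tabulate⁻ (xs , ys , eq′ , x∈′ , y∈)
... | p , q , p<q , refl , refl = suc p , suc q , s≤s p<q , refl , refl

module _ {n : ℕ} (w : 𝔖 n) where

  precedes⇒before : ∀ {a b} → Precedes w a b → Before a b (word w)
  precedes⇒before (p , q , p<q , refl , refl) = before-tabulate⁺ p<q

  before⇒precedes : ∀ {a b} → Before a b (word w) → Precedes w a b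
  before⇒precedes = before-tabulate⁻

  letter-injective : ∀ {p q} → letter w p ≡ letter w q → p ≡ q
  letter-injective eq =
    ≡.trans (sym (inverseˡ w)) (≡.trans (cong (w ⟨$⟩ˡ_) (toℕ-injective (suc-injective eq))) (inverseˡ w))

  word-unique : Unique (word w)
  word-unique = Unique.tabulate⁺ letter-injective

  ∈-word : ∀ (i : Fin n) → ⟦ i ⟧ ∈ˡ word w
  ∈-word i = subst (λ j → ⟦ j ⟧ ∈ˡ word w) (inverseʳ w) (∈-tabulate⁺ (w ⟨$⟩ˡ i))

  word-bounds : ∀ {a} → a ∈ˡ word w → 1 ≤ a × a ≤ n
  word-bounds a∈ with ∈-tabulate⁻ a∈
  ... | p , refl = s≤s z≤n , toℕ<n (w ⟨$⟩ʳ p)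

word-⊆ : ∀ {n} (v w : 𝔖 n) → word v ⊆ˡ word w
word-⊆ v w a∈ with ∈-tabulate⁻ a∈
... | p , refl = ∈-word w (v ⟨$⟩ʳ p)

word-↭ : ∀ {n} (v w : 𝔖 n) → word v ↭ word w
word-↭ v w =
  ∼bag⇒↭ (unique∧set⇒bag (word-unique v) (word-unique w) (mk⇔ (word-⊆ v w) (word-⊆ w v)))

module _ {P : Pred A 0ℓ} (P? : Decidable P) where

  count : List A → ℕ
  count xs = length (filter P? xs)

  count-++ : ∀ xs ys → count (xs ++ ys) ≡ count xs + count ys
  count-++ xs ys = ≡.trans (cong length (filter-++ P? xs ys)) (length-++ (filter P? xs))

  count-accept : P x → count (x ∷ xs) ≡ suc (count xs)
  count-accept px = cong length (filter-accept P? px)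

  count-reject : ¬ P x → count (x ∷ xs) ≡ count xs
  count-reject ¬px = cong length (filter-reject P? ¬px)

  count-++-≤ : ∀ xs ys → count xs ≤ count (xs ++ ys)
  count-++-≤ xs ys = ≤-trans (m≤m+n _ _) (≤-reflexive (sym (count-++ xs ys)))

  count-∷-≤ : ∀ x xs → count xs ≤ count (x ∷ xs)
  count-∷-≤ x xs with P? x
  ... | yes _ = n≤1+n _
  ... | no  _ = ≤-refl

  count-↭ : xs ↭ ys → count xs ≡ count ys
  count-↭ xs↭ys = ↭-length (filter-↭ P? xs↭ys)

  take-count : ∀ c xs → c ≤ count xs → ∃[ ys ] ∃[ zs ] (xs ≡ ys ++ zs × count ys ≡ c)
  take-count zero    xs       _  = [] , xs , refl , refl
  take-count (suc c) (x ∷ xs) le with P? x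
  ... | yes px with take-count c xs (≤-pred le)
  ...   | ys , zs , refl , eq = x ∷ ys , zs , refl , ≡.trans (count-accept px) (cong suc eq)
  take-count (suc c) (x ∷ xs) le | no ¬px with take-count (suc c) xs le
  ...   | ys , zs , refl , eq = x ∷ ys , zs , refl , ≡.trans (count-reject ¬px) eq

  split-count : ∀ c xs → c < count xs →
    ∃[ ys ] ∃[ x ] ∃[ zs ] (xs ≡ ys ++ x ∷ zs × P x × count ys ≡ c)
  split-count c (x ∷ xs) lt with P? x
  split-count zero    (x ∷ xs) lt | yes px = [] , x , xs , refl , px , refl
  split-count (suc c) (x ∷ xs) lt | yes px with split-count c xs (≤-pred lt)
  ... | ys , z , zs , refl , pz , eq =
    x ∷ ys , z , zs , refl , pz , ≡.trans (count-accept px) (cong suc eq)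
  split-count c (x ∷ xs) lt | no ¬px with split-count c xs lt
  ... | ys , z , zs , refl , pz , eq = x ∷ ys , z , zs , refl , pz , ≡.trans (count-reject ¬px) eq

module _ {P Q : Pred A 0ℓ} (P? : Decidable P) (Q? : Decidable Q) where

  count-mono : ∀ {xs} → All (λ x → P x → Q x) xs → count P? xs ≤ count Q? xs
  count-mono []                    = z≤n
  count-mono {x ∷ xs} (p⇒q ∷ p⇒qs) with P? x | Q? x
  ... | yes px | yes _  = s≤s (count-mono p⇒qs)
  ... | yes px | no ¬qx = contradiction (p⇒q px) ¬qx
  ... | no  _  | yes _  = m≤n⇒m≤1+n (count-mono p⇒qs)
  ... | no  _  | no  _  = count-mono p⇒qs

  -- After zs p q: the p-th P-entry of zs comes after the q-th Q-entry (both
  -- counted from 0), expressed through a cut of zs between the two.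
  After : List A → ℕ → ℕ → Set
  After zs p q = ∃[ xs ] ∃[ ys ] (zs ≡ xs ++ ys × count P? xs ≤ p × q < count Q? xs)

module _ {P : Pred ℕ 0ℓ} (P? : Decidable P) where

  count-pigeonhole : ∀ {xs ys} → Unique xs → count P? ys < count P? xs →
    ∃[ x ] (P x × x ∈ˡ xs × x ∉ ys)
  count-pigeonhole u lt with pigeonhole (Unique.filter⁺ P? u) lt
  ... | x , x∈ , x∉ with ∈-filter⁻ P? x∈
  ...   | x∈xs , px = x , px , x∈xs , λ x∈ys → x∉ (∈-filter⁺ P? x∈ys px)

-- If the p-th P-entry a of ws preceded its q-th Q-entry, there would be more
-- P-entries up to a than before the cut in vs, and fewer Q-entries before a than
-- before that cut; so some pair inverted in vs would not be inverted in ws.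
module _ {P Q : Pred ℕ 0ℓ} (P? : Decidable P) (Q? : Decidable Q)
         (disjoint : ∀ {x} → P x → ¬ Q x) where

  after-mono : ∀ {vs ws p q} → Unique vs → Unique ws → vs ↭ ws →
    (∀ {x y} → P x → Q y → Before y x vs → Before y x ws) →
    p < count P? ws → After P? Q? vs p q → After P? Q? ws p q
  after-mono {ws = ws} {p} {q} uv uw vs↭ws inv p< (xs , ys , refl , P≤p , q<Q)
    with split-count P? p ws p<
  ... | xs′ , a , zs , refl , pa , P≡p with q <? count Q? xs′
  ...   | yes q<Q′ = xs′ , a ∷ zs , refl , ≤-reflexive P≡p , q<Q′
  ...   | no  q≮Q′
    with count-pigeonhole P? {ys = xs} (unique-++⁻ˡ (xs′ ++ a ∷ []) uw′) (begin-strict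
           count P? xs                       ≤⟨ P≤p ⟩
           p                                 <⟨ n<1+n p ⟩
           suc p                             ≡⟨ +-comm 1 p ⟩
           p + 1                             ≡⟨ cong₂ _+_ P≡p (count-accept P? {xs = []} pa) ⟨
           count P? xs′ + count P? (a ∷ [])  ≡⟨ count-++ P? xs′ (a ∷ []) ⟨
           count P? (xs′ ++ a ∷ [])          ∎)
       | count-pigeonhole Q? (unique-++⁻ˡ xs uv) (≤-<-trans (≮⇒≥ q≮Q′) q<Q)
    where
    open ≤-Reasoning
    uw′ : Unique ((xs′ ++ a ∷ []) ++ zs)
    uw′ = subst Unique (sym (++-assoc xs′ (a ∷ []) zs)) uw
  -- In `vs` the letter `b₁` lies before the cut and `a₁` after it. In `ws` the letter `a₁` occurs
  -- no later than `a`, while `b₁`, which is neither in `xs′` nor equal to `a`, comes after `a`.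
  ... | a₁ , pa₁ , a₁∈ , a₁∉xs | b₁ , qb₁ , b₁∈xs , b₁∉xs′ =
    contradiction (inv pa₁ qb₁ (xs , ys , refl , b₁∈xs , a₁∈ys))
      (before-asym uw (xs′ ++ a ∷ [] , zs , sym (++-assoc xs′ (a ∷ []) zs) , a₁∈ , b₁∈zs))
    where
    a₁∈ys : a₁ ∈ˡ ys
    a₁∈ys with ∈-++⁻ xs (∈-resp-↭ (↭-sym vs↭ws) (subst (a₁ ∈ˡ_) (++-assoc xs′ (a ∷ []) zs) (∈-++⁺ˡ a₁∈)))
    ... | inj₁ a₁∈xs = contradiction a₁∈xs a₁∉xs
    ... | inj₂ a₁∈ys = a₁∈ys

    b₁∈zs : b₁ ∈ˡ zs
    b₁∈zs with ∈-++⁻ xs′ (∈-resp-↭ vs↭ws (∈-++⁺ˡ b₁∈xs))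
    ... | inj₁ b₁∈xs′        = contradiction b₁∈xs′ b₁∉xs′
    ... | inj₂ (here refl)   = contradiction qb₁ (disjoint pa)
    ... | inj₂ (there b₁∈zs) = b₁∈zs

lookup-++ : ∀ {zs : List A} xs → zs ≡ xs ++ ys → (i : Fin (length zs)) →
  (toℕ i < length xs × lookup zs i ∈ˡ xs) ⊎ (length xs ≤ toℕ i × lookup zs i ∈ˡ ys)
lookup-++ []       refl i       = inj₂ (z≤n , ∈-lookup i)
lookup-++ (x ∷ xs) refl zero    = inj₁ (s≤s z≤n , here refl)
lookup-++ (x ∷ xs) refl (suc i) with lookup-++ xs refl i
... | inj₁ (lt , x∈) = inj₁ (s≤s lt , there x∈)
... | inj₂ (le , x∈) = inj₂ (s≤s le , x∈)

module _ {P Q : Pred A 0ℓ} (P? : Decidable P) (Q? : Decidable Q) where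

  -- This and its converse translate the positions in subwords used by `I` into counts: an index
  -- into the filtered list lies left of the cut iff it is below the count of the prefix. Uniqueness
  -- turns the side on which a letter occurs into the side of its index; in the converse the index
  -- alone decides.
  before⇒after : ∀ {zs} → Unique zs → (i : Fin (count P? zs)) (j : Fin (count Q? zs)) →
    Before (lookup (filter Q? zs) j) (lookup (filter P? zs) i) zs → After P? Q? zs (toℕ i) (toℕ j)
  before⇒after u i j (xs , ys , refl , b∈xs , a∈ys)
    with lookup-++ (filter P? xs) (filter-++ P? xs ys) i
       | lookup-++ (filter Q? xs) (filter-++ Q? xs ys) j
  ... | inj₁ (_ , a∈) | _ = contradiction a∈ys (unique-++-disjoint xs u (proj₁ (∈-filter⁻ P? a∈)))
  ... | inj₂ _        | inj₂ (_ , b∈) = contradiction (proj₁ (∈-filter⁻ Q? b∈)) (unique-++-disjoint xs u b∈xs)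
  ... | inj₂ (P≤ , _) | inj₁ (<Q , _) = xs , ys , refl , P≤ , <Q

  after⇒before : ∀ {zs} (i : Fin (count P? zs)) (j : Fin (count Q? zs)) → After P? Q? zs (toℕ i) (toℕ j) →
    Before (lookup (filter Q? zs) j) (lookup (filter P? zs) i) zs
  after⇒before i j (xs , ys , refl , P≤ , <Q)
    with lookup-++ (filter P? xs) (filter-++ P? xs ys) i
       | lookup-++ (filter Q? xs) (filter-++ Q? xs ys) j
  ... | inj₁ (lt , _) | _             = contradiction P≤ (<⇒≱ lt)
  ... | inj₂ _        | inj₂ (le , _) = contradiction le (<⇒≱ <Q)
  ... | inj₂ (_ , a∈) | inj₁ (_ , b∈) = xs , ys , refl , proj₁ (∈-filter⁻ Q? b∈) , proj₁ (∈-filter⁻ P? a∈)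

-- The weak order

m<n∸o⇒o+m<n : ∀ {m n} o → m < n ∸ o → o + m < n
m<n∸o⇒o+m<n             zero    lt = lt
m<n∸o⇒o+m<n {n = suc n} (suc o) lt = s≤s (m<n∸o⇒o+m<n o lt)

<⇒+1≤ : ∀ {m n} → m < n → m + 1 ≤ n
<⇒+1≤ {m} {n} = subst (_≤ n) (+-comm 1 m)

+1≤⇒< : ∀ {m n} → m + 1 ≤ n → m < n
+1≤⇒< {m} {n} = subst (_≤ n) (+-comm m 1)

Within : ℕ → ℕ → Pred ℕ 0ℓ
Within a b x = a ≤ x × x ≤ b

within? : ∀ a b → Decidable (Within a b)
within? a b x = (a ≤? x) ×-dec (x ≤? b)

-- Distinct letters of the interval fit into the list `a, …, b`. In `split-after` this bound keeps
-- the pair built from two indices inside the rectangle of the node.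
count-within-≤ : ∀ a b → Unique xs → count (within? a b) xs ≤ suc b ∸ a
count-within-≤ {xs} a b u = subst (count (within? a b) xs ≤_) (length-applyUpTo (a +_) (suc b ∸ a))
  (unique-⊆-length (Unique.filter⁺ (within? a b) u) covered)
  where
  covered : ∀ {x} → x ∈ˡ filter (within? a b) xs → x ∈ˡ applyUpTo (a +_) (suc b ∸ a)
  covered x∈ with ∈-filter⁻ (within? a b) {xs = xs} x∈
  ... | _ , a≤x , x≤b = subst (_∈ˡ applyUpTo (a +_) (suc b ∸ a)) (m+[n∸m]≡n a≤x)
                          (∈-applyUpTo⁺ (a +_) (∸-monoˡ-< (s≤s x≤b) a≤x))

weak⇒T : (T : 𝕋 m) (v w : 𝔖 (suc m)) → v ≤R w → v ≤[ T ] w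
weak⇒T T v w v≤w (k , iT , jT , _ , _ , max , ri , rj , (p , p≡ , refl) , (q , q≡ , refl) , prec) =
  -- The node and its maximum do not involve the permutation. Both indices carry over because the
  -- subwords of `v` and `w` have equal lengths; only the letters found there change.
  k , iT , jT , _ , _ , max , ri , rj ,
  (cast eqP p , ≡.trans (cong suc (toℕ-cast eqP p)) p≡ , refl) ,
  (cast eqQ q , ≡.trans (cong suc (toℕ-cast eqQ q)) q≡ , refl) ,
  before⇒precedes w (after⇒before P? Q? (cast eqP p) (cast eqQ q) after)
  where
  P? = within? iT ⟦ k ⟧
  Q? = within? (⟦ k ⟧ + 1) jT
  eqP : count P? (word v) ≡ count P? (word w)
  eqP = count-↭ P? (word-↭ v w)
  eqQ : count Q? (word v) ≡ count Q? (word w)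
  eqQ = count-↭ Q? (word-↭ v w)
  P<Q : ∀ {x y} → Within iT ⟦ k ⟧ x → Within (⟦ k ⟧ + 1) jT y → x < y
  P<Q (_ , x≤k) (k<y , _) = ≤-<-trans x≤k (+1≤⇒< k<y)
  inverted : ∀ {x y} → Within iT ⟦ k ⟧ x → Within (⟦ k ⟧ + 1) jT y →
    Before y x (word v) → Before y x (word w)
  inverted px qy bef@(xs , ys , eq , y∈ , x∈) = precedes⇒before w (proj₂ (v≤w
    ((proj₁ (word-bounds v (subst (_ ∈ˡ_) (sym eq) (∈-++⁺ʳ xs x∈))) , P<Q px qy ,
      proj₂ (word-bounds v (subst (_ ∈ˡ_) (sym eq) (∈-++⁺ˡ y∈)))) , before⇒precedes v bef)))
  after : After P? Q? (word w) (toℕ (cast eqP p)) (toℕ (cast eqQ q))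
  after = subst₂ (After P? Q? (word w)) (sym (toℕ-cast eqP p)) (sym (toℕ-cast eqQ q))
    (after-mono P? Q? (λ px qx → <-irrefl refl (P<Q px qx)) (word-unique v) (word-unique w)
      (word-↭ v w) inverted (subst (toℕ p <_) eqP (toℕ<n p))
      (before⇒after P? Q? (word-unique v) p q (precedes⇒before v prec)))

-- Binary search trees

-- Spans a t b: the in-order labels of t are a, …, b - 1.  The letters that such
-- a subtree shuffles are a, …, b, so that a leaf carries the single letter a = b,
-- and a node k separates the letters a, …, k from k + 1, …, b.
data Spans : ℕ → Tree ℕ ⊤ → ℕ → Set where
  leaf : Spans a (leaf tt) a
  node : ∀ {l r} → Spans a l k → Spans (suc k) r b → Spans a (node l k r) b

data Consecutive : ℕ → List ℕ → ℕ → Set where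
  []  : Consecutive a [] a
  _∷_ : ∀ a → Consecutive (suc a) xs b → Consecutive a (a ∷ xs) b

consecutive-applyUpTo : ∀ {f} a m → (∀ i → f i ≡ a + i) → Consecutive a (applyUpTo f m) (a + m)
consecutive-applyUpTo a zero    f≗ = subst (Consecutive a []) (sym (+-identityʳ a)) []
consecutive-applyUpTo a (suc m) f≗ = subst₂ (λ h → Consecutive a (h ∷ _))
  (sym (≡.trans (f≗ 0) (+-identityʳ a))) (sym (+-suc a m))
  (a ∷ consecutive-applyUpTo (suc a) m (λ i → ≡.trans (f≗ (suc i)) (+-suc a i)))

-- The accumulator `xs` is what remains after the labels of `t` are read off, and `c` is where this
-- remainder starts. At a node, the remainder after the left subtree has the root label as its head.
consecutive⇒spans : ∀ t → Consecutive a (Infix.toDiffList t xs) b →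
  ∃[ c ] (Spans a t c × Consecutive c xs b)
consecutive⇒spans (leaf tt)    con = _ , leaf , con
consecutive⇒spans (node l k r) con with consecutive⇒spans l con
... | _ , sl , _ ∷ con′ with consecutive⇒spans r con′
...   | _ , sr , con″ = _ , node sl sr , con″

𝕋-spans : (T : 𝕋 m) → Spans 1 (proj₁ T) (suc m)
𝕋-spans {m} (t , eq)
  with consecutive⇒spans t (subst (λ l → Consecutive 1 l (suc m)) (sym eq)
         (consecutive-applyUpTo 1 m (λ _ → refl)))
... | _ , s , [] = s

spans-≤ : Spans a t b → a ≤ b
spans-≤ leaf         = ≤-refl
spans-≤ (node sl sr) = ≤-trans (spans-≤ sl) (≤-trans (n≤1+n _) (spans-≤ sr))

-- Split s a k b: the subtree at the node k spans a, b.
data Split : Spans a t b → ℕ → ℕ → ℕ → Set where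
  root  : ∀ {l r} {sl : Spans a l k} {sr : Spans (suc k) r b} → Split (node sl sr) a k b
  left  : ∀ {l r} {sl : Spans a l k} {sr : Spans (suc k) r b} →
          Split sl a′ k′ b′ → Split (node sl sr) a′ k′ b′
  right : ∀ {l r} {sl : Spans a l k} {sr : Spans (suc k) r b} →
          Split sr a′ k′ b′ → Split (node sl sr) a′ k′ b′

split-bounds : {s : Spans a t b} → Split s a′ k b′ → a ≤ a′ × a′ ≤ k × k < b′ × b′ ≤ b
split-bounds (root {sl = sl} {sr}) = ≤-refl , spans-≤ sl , spans-≤ sr , ≤-refl
split-bounds (left {sr = sr} sp) with split-bounds sp
... | p , q , r , b′≤ = p , q , r , ≤-trans b′≤ (≤-trans (n≤1+n _) (spans-≤ sr))
split-bounds (right {sl = sl} sp) with split-bounds sp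
... | ≤a′ , q , r , u = ≤-trans (≤-trans (spans-≤ sl) (n≤1+n _)) ≤a′ , q , r , u

split-exists : (s : Spans a t b) → a ≤ k → k < b → ∃[ a′ ] ∃[ b′ ] Split s a′ k b′
split-exists leaf a≤k k<a = contradiction a≤k (<⇒≱ k<a)
split-exists {k = k} (node {k = x} sl sr) a≤k k<b with <-cmp k x
... | tri< k<x _ _ = let a′ , b′ , sp = split-exists sl a≤k k<x in a′ , b′ , left sp
... | tri≈ _ refl _ = _ , _ , root
... | tri> _ _ x<k = let a′ , b′ , sp = split-exists sr x<k k<b in a′ , b′ , right sp

module _ {i j : ℕ} where

  -- The pairs (i , j) that I_T compares at the node k with maximum (a , b).
  Rectangle : ℕ → ℕ → ℕ → Set
  Rectangle a k b = (a ≤ i × i ≤ k) × (k < j × j ≤ b)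

  -- Where the paths to two distinct nodes part, at a label `x`, a rectangle from the left subtree
  -- has `j ≤ x`, one from the right subtree has `x < i`, and that of `x` itself has `i ≤ x < j`.
  split-disjoint : ∀ {a₁ k₁ b₁ a₂ k₂ b₂} {s : Spans a t b} →
    Split s a₁ k₁ b₁ → Split s a₂ k₂ b₂ → Rectangle a₁ k₁ b₁ → Rectangle a₂ k₂ b₂ →
    a₁ ≡ a₂ × k₁ ≡ k₂ × b₁ ≡ b₂
  split-disjoint root root _ _ = refl , refl , refl
  split-disjoint (left p)  (left q)  R S = split-disjoint p q R S
  split-disjoint (right p) (right q) R S = split-disjoint p q R S
  split-disjoint root (left q) (_ , k<j , _) (_ , _ , j≤b) =
    contradiction (≤-trans j≤b (proj₂ (proj₂ (proj₂ (split-bounds q))))) (<⇒≱ k<j)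
  split-disjoint root (right q) ((_ , i≤k) , _) ((a≤i , _) , _) =
    contradiction i≤k (<⇒≱ (≤-trans (proj₁ (split-bounds q)) a≤i))
  split-disjoint (left p) (right q) (_ , _ , j≤b) ((a≤i , i≤k) , k<j , _) =
    contradiction (≤-trans j≤b (proj₂ (proj₂ (proj₂ (split-bounds p)))))
      (<⇒≱ (<-trans (≤-trans (proj₁ (split-bounds q)) (≤-trans a≤i i≤k)) k<j))
  split-disjoint p@(left _)  q@root     R S with split-disjoint q p S R
  ... | refl , refl , refl = refl , refl , refl
  split-disjoint p@(right _) q@root     R S with split-disjoint q p S R
  ... | refl , refl , refl = refl , refl , refl
  split-disjoint p@(right _) q@(left _) R S with split-disjoint q p S R
  ... | refl , refl , refl = refl , refl , refl

bst-∈ : {s : Spans a t b} → IsBST xs t → Split s a′ k b′ → k ∈ˡ xs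
bst-∈ (node _ _)  root       = here refl
bst-∈ (node bl _) (left sp)  = there (proj₁ (∈-filter⁻ _ (bst-∈ bl sp)))
bst-∈ (node _ br) (right sp) = there (proj₁ (∈-filter⁻ _ (bst-∈ br sp)))

-- Follow the path from the root to `k`. Each proper ancestor `x` precedes `k` in the word, so
-- `i ≤ x < j` fails; since `i ≤ k < j`, the pair stays on the same side of `x` as `k`, hence within
-- the span of the next subtree.
bst-maximal : ∀ {i j} {s : Spans a t b} → IsBST xs t → Split s a′ k b′ →
  a ≤ i → i ≤ k → k < j → j ≤ b → (∀ c → Before c k xs → ¬ (i ≤ c × c < j)) → a′ ≤ i × j ≤ b′
bst-maximal _ root a≤i _ _ j≤b _ = a≤i , j≤b
bst-maximal (node {x = x} bl _) (left sp) a≤i i≤k k<j j≤b avoid with split-bounds sp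
... | _ , _ , k<b′ , b′≤x = bst-maximal bl sp a≤i i≤k k<j
  (≮⇒≥ λ x<j → avoid x (before-here (proj₁ (∈-filter⁻ _ (bst-∈ bl sp))))
    (≤-trans i≤k (<⇒≤ (<-≤-trans k<b′ b′≤x)) , x<j))
  (λ c → avoid c ∘ before-there ∘ before-filter⁻ _)
bst-maximal (node {x = x} _ br) (right sp) a≤i i≤k k<j j≤b avoid with split-bounds sp
... | x<a′ , a′≤k , _ = bst-maximal br sp
  (≰⇒> λ i≤x → avoid x (before-here (proj₁ (∈-filter⁻ _ (bst-∈ br sp))))
    (i≤x , <-trans (<-≤-trans x<a′ a′≤k) k<j))
  i≤k k<j j≤b (λ c → avoid c ∘ before-there ∘ before-filter⁻ _)

-- A label in the interval of the subtree at `k` survives every filter on the path down to `k`, and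
-- there `k` is the head of the list, with nothing before it.
bst-avoids : {s : Spans a t b} → Unique xs → IsBST xs t → Split s a′ k b′ →
  Before c k xs → ¬ (a′ ≤ c × c < b′)
bst-avoids (x∉ ∷ _) (node _ _) root bef _ with before-∷⁻ bef
... | inj₁ (_ , x∈) = All.lookup x∉ x∈ refl
... | inj₂ bef′     = All.lookup x∉ (before⇒∈ʳ bef′) refl
bst-avoids (_ ∷ u) (node {x = x} bl _) (left sp) bef (a′≤c , c<b′) with split-bounds sp | before-∷⁻ bef
... | _ , _ , _ , b′≤x    | inj₁ (refl , _) = <⇒≱ c<b′ b′≤x
... | _ , _ , k<b′ , b′≤x | inj₂ bef′ = bst-avoids (Unique.filter⁺ (_<? x) u) bl sp
  (before-filter⁺ (_<? x) bef′ (<-≤-trans c<b′ b′≤x) (<-≤-trans k<b′ b′≤x)) (a′≤c , c<b′)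
bst-avoids (_ ∷ u) (node {x = x} _ br) (right sp) bef (a′≤c , c<b′) with split-bounds sp | before-∷⁻ bef
... | x<a′ , _ | inj₁ (refl , _) = <⇒≱ x<a′ a′≤c
... | x<a′ , a′≤k , _ | inj₂ bef′ = bst-avoids (Unique.filter⁺ (x <?_) u) br sp
  (before-filter⁺ (x <?_) bef′ (<-≤-trans x<a′ a′≤c) (<-≤-trans x<a′ a′≤k)) (a′≤c , c<b′)

-- A canonical word whose binary search tree is the given one. It is needed because membership in
-- `ℛ` asks for some such word.
preorder : Tree ℕ ⊤ → List ℕ
preorder (leaf tt)    = []
preorder (node l k r) = k ∷ preorder l ++ preorder r

preorder-bounds : Spans a t b → x ∈ˡ preorder t → a ≤ x × x < b
preorder-bounds {t = node l k r} (node sl sr) (here refl) = spans-≤ sl , spans-≤ sr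
preorder-bounds {t = node l k r} (node sl sr) (there x∈) with ∈-++⁻ (preorder l) x∈
... | inj₁ x∈l = let a≤x , x<k = preorder-bounds sl x∈l in
                 a≤x , <-≤-trans x<k (≤-trans (n≤1+n _) (spans-≤ sr))
... | inj₂ x∈r = let k<x , x<b = preorder-bounds sr x∈r in
                 ≤-trans (spans-≤ sl) (<⇒≤ k<x) , x<b

preorder-isBST : Spans a t b → IsBST (preorder t) t
preorder-isBST leaf = leaf
preorder-isBST {t = node l k r} (node sl sr) = node
  (subst (λ xs → IsBST xs l) (sym below) (preorder-isBST sl))
  (subst (λ xs → IsBST xs r) (sym above) (preorder-isBST sr))
  where
  l<k : All (_< k) (preorder l)
  l<k = All.tabulate (proj₂ ∘ preorder-bounds sl)
  k<r : All (k <_) (preorder r)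
  k<r = All.tabulate (proj₁ ∘ preorder-bounds sr)
  below : filter (_<? k) (preorder l ++ preorder r) ≡ preorder l
  below = ≡.trans (filter-++ (_<? k) (preorder l) _)
    (≡.trans (cong₂ _++_ (filter-all (_<? k) l<k) (filter-none (_<? k) (All.map <⇒≯ k<r)))
      (++-identityʳ _))
  above : filter (k <?_) (preorder l ++ preorder r) ≡ preorder r
  above = ≡.trans (filter-++ (k <?_) (preorder l) _)
    (cong₂ _++_ (filter-none (k <?_) (All.map <⇒≯ l<k)) (filter-all (k <?_) k<r))

preorder-↭-infix : ∀ t {xs} → preorder t ++ xs ↭ Infix.toDiffList t xs
preorder-↭-infix (leaf tt)         = refl
preorder-↭-infix (node l k r) {xs} = begin
  k ∷ (preorder l ++ preorder r) ++ xs          ≡⟨ cong (k ∷_) (++-assoc (preorder l) _ xs) ⟩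
  k ∷ preorder l ++ preorder r ++ xs            ↭⟨ shift k (preorder l) _ ⟨
  preorder l ++ k ∷ preorder r ++ xs            ↭⟨ ++⁺ˡ (preorder l) (prep k (preorder-↭-infix r)) ⟩
  preorder l ++ k ∷ Infix.toDiffList r xs       ↭⟨ preorder-↭-infix l ⟩
  Infix.toDiffList l (k ∷ Infix.toDiffList r xs)  ∎
  where open PermutationReasoning

-- The rearrangement sends each position of `xs` to the index of its letter in `1, …, m`, and this
-- index, counted from 0, is the letter minus one.
↭⇒word : ∀ {m xs} → xs ↭ applyUpTo suc m → Σ[ σ ∈ 𝔖 m ] (word σ ≡ xs)
↭⇒word {m} {xs} perm with ≡.trans (sym (length-applyUpTo suc m)) (sym (↭-length perm))
... | refl = π , ≡.trans (tabulate-cong agrees) (tabulate-lookup xs)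
  where
  permₛ = ↭⇒↭ₛ perm
  len = length-applyUpTo suc (length xs)
  π = onIndices permₛ ∘ₚ cast-id len
  agrees : ∀ i → letter π i ≡ lookup xs i
  agrees i = ≡.trans (cong suc (toℕ-cast len _))
    (≡.trans (sym (lookup-applyUpTo suc (length xs) _)) (sym (onIndices-lookup (≡.setoid ℕ) permₛ i)))

-- The maxima of the sets `ℛ T k`, and `I T` in terms of counts

module _ (T : 𝕋 m) where

  private
    s = 𝕋-spans T

  representative : Σ[ σ ∈ 𝔖 m ] IsBST (word σ) (proj₁ T)
  representative with ↭⇒word (≡.subst₂ _↭_ (++-identityʳ _) (proj₂ T) (preorder-↭-infix (proj₁ T)))
  ... | σ , eq = σ , subst (λ xs → IsBST xs (proj₁ T)) (sym eq) (preorder-isBST s)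

  -- Membership is witnessed by the preorder word through `bst-avoids`; maximality must treat every
  -- word `τ` with tree `T`, which `bst-maximal` allows.
  ℛ-maximum : ∀ {k} → Split s a ⟦ k ⟧ b → IsMaximum (ℛ T k) (a , b)
  ℛ-maximum {a} {b} {k} sp =
    (σ , bst , (1≤a , ≤-<-trans a≤k k<b , b≤n) , (a≤k , <⇒+1≤ k<b) , avoids) , maximal
    where
    σ = proj₁ representative
    bst = proj₂ representative
    1≤a = proj₁ (split-bounds sp)
    a≤k = proj₁ (proj₂ (split-bounds sp))
    k<b = proj₁ (proj₂ (proj₂ (split-bounds sp)))
    b≤n = proj₂ (proj₂ (proj₂ (split-bounds sp)))
    avoids : ∀ ℓ → ℓ Fin.< σ ⟨$⟩ˡ k → ¬ ((letter σ ℓ , letter σ ℓ + 1) ⊑ (a , b))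
    avoids ℓ ℓ< (a≤ , ≤b) = bst-avoids (word-unique σ) bst sp
      (subst (λ p → Before (letter σ ℓ) ⟦ p ⟧ (word σ)) (inverseʳ σ) (before-tabulate⁺ ℓ<))
      (a≤ , +1≤⇒< ≤b)
    maximal : ∀ y → y ∈ ℛ T k → y ⊑ (a , b)
    maximal (i , j) (τ , bst′ , (1≤i , _ , j≤n) , (i≤k , k<j) , avoid) =
      bst-maximal bst′ sp 1≤i i≤k (+1≤⇒< k<j) j≤n avoid′
      where
      avoid′ : ∀ c → Before c ⟦ k ⟧ (word τ) → ¬ (i ≤ c × c < j)
      avoid′ c bef (i≤c , c<j) with before⇒precedes τ bef
      ... | p , q , p<q , refl , eq =
        avoid p (subst (p Fin.<_) q≡ p<q) (i≤c , <⇒+1≤ c<j)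
        where
        q≡ : q ≡ τ ⟨$⟩ˡ k
        q≡ = letter-injective τ (≡.trans eq (cong ⟦_⟧ (sym (inverseʳ τ))))

  maximum-unique : ∀ {S x y} → IsMaximum S x → IsMaximum S y → x ≡ y
  maximum-unique (x∈ , x-max) (y∈ , y-max) with x-max _ y∈ | y-max _ x∈
  ... | p , q | p′ , q′ = cong₂ _,_ (≤-antisym p p′) (≤-antisym q′ q)

  -- With indices from 0, the comparison of the `p`-th small and the `q`-th large letter at `k` is
  -- recorded in `I T` by the pair `(a + p , k + 1 + q)`, so inclusion is applied to that pair.
  split-after : ∀ {v w : 𝔖 (suc m)} {k p q} → v ≤[ T ] w → Split s a ⟦ k ⟧ b →
    p < count (within? a ⟦ k ⟧) (word v) →
    After (within? a ⟦ k ⟧) (within? (⟦ k ⟧ + 1) b) (word v) p q →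
    After (within? a ⟦ k ⟧) (within? (⟦ k ⟧ + 1) b) (word w) p q
  split-after {a} {b} {v} {w} {k} {p} {q} v≤w sp p< aft@(xs , ys , eq , _ , q<xs) = from-I (v≤w to-I)
    where
    P? = within? a ⟦ k ⟧
    Q? = within? (⟦ k ⟧ + 1) b

    q< : q < count Q? (word v)
    q< = <-≤-trans q<xs (subst (λ zs → count Q? xs ≤ count Q? zs) (sym eq) (count-++-≤ Q? xs ys))

    i≤k : a + p ≤ ⟦ k ⟧
    i≤k = ≤-pred (m<n∸o⇒o+m<n a (<-≤-trans p< (count-within-≤ a ⟦ k ⟧ (word-unique v))))

    k+1+q : ⟦ k ⟧ + suc q ≡ ⟦ k ⟧ + 1 + q
    k+1+q = sym (+-assoc ⟦ k ⟧ 1 q)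

    j≤b : ⟦ k ⟧ + suc q ≤ b
    j≤b = subst (_≤ b) (sym k+1+q) (≤-pred
      (m<n∸o⇒o+m<n (⟦ k ⟧ + 1) (<-≤-trans q< (count-within-≤ (⟦ k ⟧ + 1) b (word-unique v)))))

    rectangle : Rectangle a ⟦ k ⟧ b
    rectangle = (m≤m+n a p , i≤k) , (m<m+n ⟦ k ⟧ (s≤s z≤n) , j≤b)

    p-index : suc p ≡ a + p ∸ a + 1
    p-index = ≡.trans (+-comm 1 p) (cong (_+ 1) (sym (m+n∸m≡n a p)))

    q-index : suc q ≡ ⟦ k ⟧ + suc q ∸ ⟦ k ⟧
    q-index = sym (m+n∸m≡n ⟦ k ⟧ (suc q))

    to-I : (a + p , ⟦ k ⟧ + suc q) ∈ I T v
    to-I =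
      k , a , b , _ , _ , ℛ-maximum sp ,
      proj₁ rectangle , (<⇒+1≤ (proj₁ (proj₂ rectangle)) , j≤b) ,
      (fromℕ< p< , ≡.trans (cong suc (toℕ-fromℕ< p<)) p-index , refl) ,
      (fromℕ< q< , ≡.trans (cong suc (toℕ-fromℕ< q<)) q-index , refl) ,
      before⇒precedes v (after⇒before P? Q? (fromℕ< p<) (fromℕ< q<)
        (subst₂ (After P? Q? (word v)) (sym (toℕ-fromℕ< p<)) (sym (toℕ-fromℕ< q<)) aft))

    from-I : (a + p , ⟦ k ⟧ + suc q) ∈ I T w → After P? Q? (word w) p q
    from-I (k′ , _ , _ , _ , _ , max′ , ri , (k<j , j≤) , (p′ , p≡ , refl) , (q′ , q≡ , refl) , prec)
      -- Membership in `I T w` names some node `k′` and some maximum. The maximum must be the one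
      -- computed from the tree, and disjointness of rectangles then forces `k′` to be `k`.
      with split-exists s (s≤s z≤n) (s≤s (toℕ<n k′))
    ... | a′ , b′ , sp′ with maximum-unique max′ (ℛ-maximum sp′)
    ... | refl with split-disjoint sp sp′ rectangle (ri , +1≤⇒< k<j , j≤)
    ... | refl , k≡k′ , refl with toℕ-injective (suc-injective k≡k′)
    ... | refl = subst₂ (After P? Q? (word w))
      (suc-injective (≡.trans p≡ (sym p-index))) (suc-injective (≡.trans q≡ (sym q-index)))
      (before⇒after P? Q? (word-unique w) p′ q′ (precedes⇒before w prec))

-- Dominance along the tree

module _ {P Q R : Pred A 0ℓ} (P? : Decidable P) (Q? : Decidable Q) (R? : Decidable R) where

  count-⊎-≤ : (∀ {x} → P x → Q x ⊎ R x) → ∀ xs → count P? xs ≤ count Q? xs + count R? xs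
  count-⊎-≤ P⇒ []       = z≤n
  count-⊎-≤ P⇒ (x ∷ xs) with P? x | Q? x | R? x
  ... | no _   | no _   | no _  = count-⊎-≤ P⇒ xs
  ... | no _   | yes _  | no _  = m≤n⇒m≤1+n (count-⊎-≤ P⇒ xs)
  ... | no _   | no _   | yes _ = ≤-trans (count-⊎-≤ P⇒ xs) (+-monoʳ-≤ _ (n≤1+n _))
  ... | no _   | yes _  | yes _ = m≤n⇒m≤1+n (≤-trans (count-⊎-≤ P⇒ xs) (+-monoʳ-≤ _ (n≤1+n _)))
  ... | yes _  | yes _  | no _  = s≤s (count-⊎-≤ P⇒ xs)
  ... | yes _  | yes _  | yes _ = s≤s (≤-trans (count-⊎-≤ P⇒ xs) (+-monoʳ-≤ _ (n≤1+n _)))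
  ... | yes _  | no _   | yes _ = ≤-trans (s≤s (count-⊎-≤ P⇒ xs)) (≤-reflexive (sym (+-suc _ _)))
  ... | yes px | no ¬qx | no ¬rx = contradiction (P⇒ px) [ ¬qx , ¬rx ]′

  count-⊎-≥ : (∀ {x} → Q x → P x) → (∀ {x} → R x → P x) → (∀ {x} → Q x → ¬ R x) →
    ∀ xs → count Q? xs + count R? xs ≤ count P? xs
  count-⊎-≥ Q⇒ R⇒ QR []       = z≤n
  count-⊎-≥ Q⇒ R⇒ QR (x ∷ xs) with P? x | Q? x | R? x
  ... | _      | yes qx | yes rx = contradiction rx (QR qx)
  ... | no ¬px | yes qx | _      = contradiction (Q⇒ qx) ¬px
  ... | no ¬px | _      | yes rx = contradiction (R⇒ rx) ¬px
  ... | no _   | no _   | no _   = count-⊎-≥ Q⇒ R⇒ QR xs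
  ... | yes _  | no _   | no _   = m≤n⇒m≤1+n (count-⊎-≥ Q⇒ R⇒ QR xs)
  ... | yes _  | yes _  | no _   = s≤s (count-⊎-≥ Q⇒ R⇒ QR xs)
  ... | yes _  | no _   | yes _  = ≤-trans (≤-reflexive (+-suc _ _)) (s≤s (count-⊎-≥ Q⇒ R⇒ QR xs))

#[_,_] : ℕ → ℕ → List ℕ → ℕ
#[ a , b ] = count (within? a b)

#-split : a ≤ suc k → k ≤ b → ∀ xs → #[ a , b ] xs ≡ #[ a , k ] xs + #[ suc k , b ] xs
#-split {a} {k} {b} a≤ k≤b xs = ≤-antisym
  (count-⊎-≤ (within? a b) (within? a k) (within? (suc k) b) cases xs)
  (count-⊎-≥ (within? a b) (within? a k) (within? (suc k) b)
    (λ (a≤x , x≤k) → a≤x , ≤-trans x≤k k≤b)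
    (λ (k<x , x≤b) → ≤-trans a≤ k<x , x≤b)
    (λ (_ , x≤k) (k<x , _) → <⇒≱ k<x x≤k) xs)
  where
  cases : ∀ {x} → Within a b x → Within a k x ⊎ Within (suc k) b x
  cases {x} (a≤x , x≤b) with x ≤? k
  ... | yes x≤k = inj₁ (a≤x , x≤k)
  ... | no  x≰k = inj₂ (≰⇒> x≰k , x≤b)

#-empty : b < a → ∀ xs → #[ a , b ] xs ≡ 0
#-empty {b} {a} b<a xs =
  cong length (filter-none (within? a b) (All.universal (λ x (a≤x , x≤b) → <⇒≱ b<a (≤-trans a≤x x≤b)) xs))

#-antitone : a ≤ a′ → ∀ xs → #[ a′ , b ] xs ≤ #[ a , b ] xs
#-antitone {a} {a′} {b} a≤a′ xs = count-mono (within? a′ b) (within? a b)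
  (All.universal (λ x (a′≤x , x≤b) → ≤-trans a≤a′ a′≤x , x≤b) xs)

-- The tableau criterion for the subwords of vs and ws with letters in a, …, b.
record Dominated (a b : ℕ) (vs ws : List ℕ) : Set where
  field
    #-mono : ∀ xs ys xs′ ys′ → vs ≡ xs ++ ys → ws ≡ xs′ ++ ys′ → #[ a , b ] xs ≡ #[ a , b ] xs′ →
      ∀ q → a ≤ q → #[ q , b ] xs ≤ #[ q , b ] xs′

open Dominated

-- What inclusion of `I T` yields at a single node. The bound on `p` restricts to indices at which a
-- small letter exists, since `I T` has pairs only for these.
AfterMono : List ℕ → List ℕ → ℕ → ℕ → ℕ → Set
AfterMono vs ws a k b = ∀ {p q} → p < #[ a , k ] vs →
  After (within? a k) (within? (suc k) b) vs p q → After (within? a k) (within? (suc k) b) ws p q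

module _ {vs ws : List ℕ} (#≡ : ∀ a b → #[ a , b ] vs ≡ #[ a , b ] ws) where

  dominated-leaf : Dominated a a vs ws
  dominated-leaf {a} .#-mono xs _ xs′ _ _ _ eq q a≤q with m≤n⇒m<n∨m≡n a≤q
  ... | inj₁ a<q  = subst (_≤ #[ q , a ] xs′) (sym (#-empty a<q xs)) z≤n
  ... | inj₂ refl = ≤-reflexive eq

  module _ {a k b : ℕ} (a≤k : a ≤ k) (k<b : k < b) (mono : AfterMono vs ws a k b)
           (xs ys xs′ ys′ : List ℕ) (vs≡ : vs ≡ xs ++ ys) (ws≡ : ws ≡ xs′ ++ ys′)
           (eq : #[ a , b ] xs ≡ #[ a , b ] xs′) where

    parts-≡ : #[ a , k ] xs + #[ suc k , b ] xs ≡ #[ a , k ] xs′ + #[ suc k , b ] xs′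
    parts-≡ = ≡.trans (sym (#-split (m≤n⇒m≤1+n a≤k) (<⇒≤ k<b) xs))
      (≡.trans eq (#-split (m≤n⇒m≤1+n a≤k) (<⇒≤ k<b) xs′))

    module _ (lt : #[ suc k , b ] xs′ < #[ suc k , b ] xs) where

      fewer-small : #[ a , k ] xs < #[ a , k ] xs′
      fewer-small = +-cancelʳ-< (#[ suc k , b ] xs′) _ _
        (<-≤-trans (+-monoʳ-< (#[ a , k ] xs) lt) (≤-reflexive parts-≡))

      enough-small : #[ a , k ] xs < #[ a , k ] vs
      enough-small = <-≤-trans fewer-small (≤-trans (count-++-≤ (within? a k) xs′ ys′)
        (≤-reflexive (≡.trans (cong #[ a , k ] (sym ws≡)) (sym (#≡ a k)))))

      not-fewer-large : ⊥
      -- Take for `p` the number of small letters in `xs` and for `q` the number of large letters in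
      -- `xs′`. The resulting cut `xs″` of `ws` has at most `p` small and more than `q` large
      -- letters: it has too many large letters to be a prefix of `xs′`, and too few small ones to
      -- extend it.
      not-fewer-large with mono enough-small (xs , ys , vs≡ , ≤-refl , lt)
      ... | xs″ , ys″ , ws≡″ , few , many with ++-comparable xs″ xs′ (≡.trans (sym ws≡″) ws≡)
      ...   | inj₁ (zs , refl , _) = <⇒≱ many (count-++-≤ (within? (suc k) b) xs″ zs)
      ...   | inj₂ (zs , refl , _) = <⇒≱ fewer-small (≤-trans (count-++-≤ (within? a k) xs′ zs) few)

    large-≤ : #[ suc k , b ] xs ≤ #[ suc k , b ] xs′
    large-≤ = ≮⇒≥ not-fewer-large

    small-≥ : #[ a , k ] xs′ ≤ #[ a , k ] xs
    small-≥ = +-cancelʳ-≤ (#[ suc k , b ] xs) _ _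
      (≤-trans (+-monoʳ-≤ (#[ a , k ] xs′) large-≤) (≤-reflexive (sym parts-≡)))

    -- By `large-≤`, the prefix `xs` can be lengthened until it has as many large letters as `xs′`.
    -- Lengthening only increases the left-hand count, and the right subtree handles the longer
    -- prefix.
    dominated-large : Dominated (suc k) b vs ws → ∀ {q} → k < q → #[ q , b ] xs ≤ #[ q , b ] xs′
    dominated-large dom {q} k<q with take-count (within? (suc k) b) missing ys missing-≤
      where
      open ≤-Reasoning
      missing = #[ suc k , b ] xs′ ∸ #[ suc k , b ] xs
      xs′-≤ : #[ suc k , b ] xs′ ≤ #[ suc k , b ] xs + #[ suc k , b ] ys
      xs′-≤ = begin
        #[ suc k , b ] xs′                     ≤⟨ count-++-≤ (within? (suc k) b) xs′ ys′ ⟩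
        #[ suc k , b ] (xs′ ++ ys′)            ≡⟨ cong #[ suc k , b ] ws≡ ⟨
        #[ suc k , b ] ws                      ≡⟨ #≡ (suc k) b ⟨
        #[ suc k , b ] vs                      ≡⟨ cong #[ suc k , b ] vs≡ ⟩
        #[ suc k , b ] (xs ++ ys)              ≡⟨ count-++ (within? (suc k) b) xs ys ⟩
        #[ suc k , b ] xs + #[ suc k , b ] ys  ∎
      missing-≤ : missing ≤ #[ suc k , b ] ys
      missing-≤ = m≤n+o⇒m∸n≤o (#[ suc k , b ] xs′) (#[ suc k , b ] xs) xs′-≤
    ... | ys₁ , ys₂ , refl , ys₁≡ = ≤-trans (count-++-≤ (within? q b) xs ys₁)
      (dom .#-mono (xs ++ ys₁) ys₂ xs′ ys′ (≡.trans vs≡ (sym (++-assoc xs ys₁ ys₂))) ws≡ extended-≡ q k<q)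
      where
      extended-≡ : #[ suc k , b ] (xs ++ ys₁) ≡ #[ suc k , b ] xs′
      extended-≡ = ≡.trans (count-++ (within? (suc k) b) xs ys₁)
        (≡.trans (cong (#[ suc k , b ] xs +_) ys₁≡) (m+[n∸m]≡n large-≤))

    -- By `small-≥`, the prefix `xs` can be shortened to `us` with as many small letters as `xs′`,
    -- and the left subtree handles `us`. The small letters cut off are exactly as many as the large
    -- letters that `xs′` has in excess of `xs`, and each of those is at least `q`.
    dominated-small : Dominated a k vs ws → ∀ {q} → a ≤ q → q ≤ k → #[ q , b ] xs ≤ #[ q , b ] xs′
    dominated-small dom {q} a≤q q≤k with take-count (within? a k) (#[ a , k ] xs′) xs small-≥
    ... | us , zs , refl , us≡ = begin
      #[ q , b ] (us ++ zs)                ≡⟨ #-split (m≤n⇒m≤1+n q≤k) (<⇒≤ k<b) (us ++ zs) ⟩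
      #[ q , k ] (us ++ zs) + L            ≡⟨ cong (_+ L) (count-++ (within? q k) us zs) ⟩
      #[ q , k ] us + #[ q , k ] zs + L    ≤⟨ +-monoˡ-≤ L (+-mono-≤ us-≤ (#-antitone a≤q zs)) ⟩
      #[ q , k ] xs′ + #[ a , k ] zs + L   ≡⟨ +-assoc (#[ q , k ] xs′) _ L ⟩
      #[ q , k ] xs′ + (#[ a , k ] zs + L) ≡⟨ cong (#[ q , k ] xs′ +_) rest ⟩
      #[ q , k ] xs′ + #[ suc k , b ] xs′  ≡⟨ #-split (m≤n⇒m≤1+n q≤k) (<⇒≤ k<b) xs′ ⟨
      #[ q , b ] xs′                       ∎
      where
      open ≤-Reasoning
      L = #[ suc k , b ] (us ++ zs)
      us-≤ : #[ q , k ] us ≤ #[ q , k ] xs′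
      us-≤ = dom .#-mono us (zs ++ ys) xs′ ys′ (≡.trans vs≡ (++-assoc us zs ys)) ws≡ us≡ q a≤q
      whole : #[ a , k ] (us ++ zs) ≡ #[ a , k ] xs′ + #[ a , k ] zs
      whole = ≡.trans (count-++ (within? a k) us zs) (cong (_+ #[ a , k ] zs) us≡)
      rest : #[ a , k ] zs + L ≡ #[ suc k , b ] xs′
      rest = +-cancelˡ-≡ (#[ a , k ] xs′) _ _ (≡.trans (sym (+-assoc (#[ a , k ] xs′) _ L))
        (≡.trans (cong (_+ L) (sym whole)) parts-≡))

  dominated-node : a ≤ k → k < b → AfterMono vs ws a k b →
    Dominated a k vs ws → Dominated (suc k) b vs ws → Dominated a b vs ws
  dominated-node {k = k} a≤k k<b mono small large .#-mono xs ys xs′ ys′ vs≡ ws≡ eq q a≤q with q ≤? k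
  ... | yes q≤k = dominated-small a≤k k<b mono xs ys xs′ ys′ vs≡ ws≡ eq small a≤q q≤k
  ... | no  q≰k = dominated-large a≤k k<b mono xs ys xs′ ys′ vs≡ ws≡ eq large (≰⇒> q≰k)

  spans-dominated : (s : Spans a t b) → (∀ {a k b} → Split s a k b → AfterMono vs ws a k b) → Dominated a b vs ws
  spans-dominated leaf         mono = dominated-leaf
  spans-dominated (node sl sr) mono = dominated-node (spans-≤ sl) (spans-≤ sr) (mono root)
    (spans-dominated sl (mono ∘ left)) (spans-dominated sr (mono ∘ right))

-- The tableau criterion

data Exchange : List ℕ → List ℕ → Set where
  exchange : ∀ ps ms {ss x y} → x < y → Exchange (ps ++ x ∷ ms ++ y ∷ ss) (ps ++ y ∷ ms ++ x ∷ ss)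

exchange-∷ : ∀ z → Exchange xs ys → Exchange (z ∷ xs) (z ∷ ys)
exchange-∷ z (exchange ps ms x<y) = exchange (z ∷ ps) ms x<y

swap-ends : ∀ x y (ms : List A) {ss} → x ∷ ms ++ y ∷ ss ↭ y ∷ ms ++ x ∷ ss
swap-ends x y ms {ss} = begin
  x ∷ ms ++ y ∷ ss  ↭⟨ prep x (shift y ms ss) ⟩
  x ∷ y ∷ ms ++ ss  ↭⟨ swap x y refl ⟩
  y ∷ x ∷ ms ++ ss  ↭⟨ prep y (shift x ms ss) ⟨
  y ∷ ms ++ x ∷ ss  ∎
  where open PermutationReasoning

#≥ : ℕ → List ℕ → ℕ
#≥ q = count (q ≤?_)

-- The usual comparison of sorted prefixes: for equal lengths, one sorted prefix is entrywise below
-- another iff for every `q` it has no more letters that are at least `q`.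
record Tableau (vs ws : List ℕ) : Set where
  field
    #≥-mono : ∀ xs ys xs′ ys′ → vs ≡ xs ++ ys → ws ≡ xs′ ++ ys′ → length xs ≡ length xs′ →
      ∀ q → #≥ q xs ≤ #≥ q xs′

open Tableau

tableau-∷⁻ : Tableau (x ∷ xs) (x ∷ ys) → Tableau xs ys
tableau-∷⁻ {x} tab .#≥-mono us vs us′ vs′ refl refl eq q
  with tab .#≥-mono (x ∷ us) vs (x ∷ us′) vs′ refl refl (cong suc eq) q
... | le with q ≤? x
...   | yes q≤x = ≤-pred (subst₂ _≤_ (count-accept (q ≤?_) q≤x) (count-accept (q ≤?_) q≤x) le)
...   | no  q≰x = subst₂ _≤_ (count-reject (q ≤?_) q≰x) (count-reject (q ≤?_) q≰x) le

tableau-head : Tableau (x ∷ xs) (y ∷ ys) → x ≤ y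
tableau-head {x} {xs} {y} {ys} tab with x ≤? y | tab .#≥-mono (x ∷ []) xs (y ∷ []) ys refl refl refl x
... | yes x≤y | _  = x≤y
... | no  x≰y | le = contradiction
  (subst₂ _≤_ (count-accept (x ≤?_) {xs = []} ≤-refl) (count-reject (x ≤?_) {xs = []} x≰y) le) λ ()

-- Exchanging the head x with the first letter b of (x , y], where y is the head
-- of the target, keeps the criterion: for x < q ≤ b a prefix us of ms has no
-- letter in (x , y], so that its letters ≥ q are those > y.
module _ {x b y : ℕ} {ms ss ws : List ℕ} (x<b : x < b) (b≤y : b ≤ y)
         (first : #[ suc x , y ] ms ≡ 0) (tab : Tableau (x ∷ ms ++ b ∷ ss) (y ∷ ws)) where

  prefix-≤ : ∀ us {vs us′ vs′} → ms ≡ us ++ vs → ws ≡ us′ ++ vs′ → length us ≡ length us′ →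
    ∀ q → #≥ q (x ∷ us) ≤ #≥ q (y ∷ us′)
  prefix-≤ us {vs} {us′} {vs′} refl refl eq = tab .#≥-mono (x ∷ us) (vs ++ b ∷ ss) (y ∷ us′) vs′
    (cong (x ∷_) (++-assoc us vs _)) refl (cong suc eq)

  open ≤-Reasoning

  exchange-inside : ∀ us {vs us′ vs′} → ms ≡ us ++ vs → ws ≡ us′ ++ vs′ → length us ≡ length us′ →
    ∀ q → #≥ q (b ∷ us) ≤ #≥ q (y ∷ us′)
  exchange-inside us {vs} {us′} {vs′} refl refl eq q with q ≤? x | q ≤? b
  ... | yes q≤x | _ = begin
    #≥ q (b ∷ us)   ≡⟨ count-accept (q ≤?_) (≤-trans q≤x (<⇒≤ x<b)) ⟩
    suc (#≥ q us)   ≡⟨ count-accept (q ≤?_) q≤x ⟨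
    #≥ q (x ∷ us)   ≤⟨ prefix-≤ us refl refl eq q ⟩
    #≥ q (y ∷ us′)  ∎
  ... | no _ | no q≰b = begin
    #≥ q (b ∷ us)   ≡⟨ count-reject (q ≤?_) q≰b ⟩
    #≥ q us         ≤⟨ count-∷-≤ (q ≤?_) x us ⟩
    #≥ q (x ∷ us)   ≤⟨ prefix-≤ us refl refl eq q ⟩
    #≥ q (y ∷ us′)  ∎
  -- The criterion is used at the threshold `y + 1`, where neither head counts; on returning to `q`,
  -- the head `y` pays for the extra letter `b`.
  ... | no q≰x | yes q≤b = begin
    #≥ q (b ∷ us)                              ≡⟨ count-accept (q ≤?_) q≤b ⟩
    suc (#≥ q us)                              ≤⟨ s≤s (count-⊎-≤ (q ≤?_) (within? (suc x) y) (suc y ≤?_)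
                                                    cases us) ⟩
    suc (#[ suc x , y ] us + #≥ (suc y) us)    ≡⟨ cong (λ c → suc (c + #≥ (suc y) us)) none ⟩
    suc (#≥ (suc y) us)                        ≤⟨ s≤s (count-∷-≤ (suc y ≤?_) x us) ⟩
    suc (#≥ (suc y) (x ∷ us))                  ≤⟨ s≤s (prefix-≤ us refl refl eq (suc y)) ⟩
    suc (#≥ (suc y) (y ∷ us′))                 ≡⟨ cong suc (count-reject (suc y ≤?_) 1+n≰n) ⟩
    suc (#≥ (suc y) us′)                       ≤⟨ s≤s (count-mono (suc y ≤?_) (q ≤?_)
                                                    (All.universal (λ _ y<z → ≤-trans q≤y (<⇒≤ y<z)) us′)) ⟩
    suc (#≥ q us′)                             ≡⟨ count-accept (q ≤?_) q≤y ⟨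
    #≥ q (y ∷ us′)                             ∎
    where
    q≤y = ≤-trans q≤b b≤y
    cases : ∀ {z} → q ≤ z → Within (suc x) y z ⊎ y < z
    cases {z} q≤z with z ≤? y
    ... | yes z≤y = inj₁ (≤-trans (≰⇒> q≰x) q≤z , z≤y)
    ... | no  z≰y = inj₂ (≰⇒> z≰y)
    none : #[ suc x , y ] us ≡ 0
    none = n≤0⇒n≡0 (subst (#[ suc x , y ] us ≤_) first (count-++-≤ (within? (suc x) y) us vs))

  exchange-tableau : Tableau (b ∷ ms ++ x ∷ ss) (y ∷ ws)
  exchange-tableau .#≥-mono [] _ _ _ _ _ _ _ = z≤n
  exchange-tableau .#≥-mono (_ ∷ us) vs (_ ∷ us′) vs′ eqv refl eq q with ∷-injective eqv
  ... | refl , eqv′ with ++-comparable ms us eqv′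
  ...   | inj₂ (zs , ms≡ , _) = exchange-inside us ms≡ refl (suc-injective eq) q
  ...   | inj₁ ([] , us≡ , _) =
    exchange-inside us (sym (≡.trans (++-identityʳ us) (≡.trans us≡ (++-identityʳ ms)))) refl (suc-injective eq) q
  -- A prefix that reaches past both exchanged positions is merely rearranged, so its counts are
  -- unchanged.
  ...   | inj₁ (_ ∷ zs , refl , refl) = subst (_≤ #≥ q (y ∷ us′)) (count-↭ (q ≤?_) (swap-ends x b ms))
    (tab .#≥-mono (x ∷ ms ++ b ∷ zs) vs (y ∷ us′) vs′ (cong (x ∷_) (sym (++-assoc ms (b ∷ zs) vs))) refl
      (≡.trans (↭-length (swap-ends x b ms)) eq) q)

-- Raise the head by exchanges until it equals that of the target, then drop both heads and continue
-- with the tails.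
tableau⇒exchanges : ∀ {vs} ws → vs ↭ ws → Tableau vs ws → Star Exchange vs ws
-- `fuel` bounds the distance from `x` up to `y`; each exchange strictly raises the head without
-- passing `y`.
descend : ∀ fuel {x vs y} ws → y ≤ x + fuel → x ∷ vs ↭ y ∷ ws → Tableau (x ∷ vs) (y ∷ ws) →
  Star Exchange (x ∷ vs) (y ∷ ws)

tableau⇒exchanges []       vs↭ws tab with ↭-empty-inv vs↭ws
... | refl = ε
tableau⇒exchanges {[]}     (y ∷ ws) vs↭ws tab with ↭-empty-inv (↭-sym vs↭ws)
... | ()
tableau⇒exchanges {x ∷ vs} (y ∷ ws) vs↭ws tab = descend y ws (m≤n+m y x) vs↭ws tab

descend fuel {x} {vs} {y} ws y≤ vs↭ws tab with x ≟ y
... | yes refl = gmap (x ∷_) (exchange-∷ x) (tableau⇒exchanges ws (drop-∷ vs↭ws) (tableau-∷⁻ tab))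
... | no x≢y with ≤∧≢⇒< (tableau-head tab) x≢y | fuel
...   | x<y | zero = contradiction (subst (y ≤_) (+-identityʳ x) y≤) (<⇒≱ x<y)
...   | x<y | suc fuel′ with ∈-resp-↭ (↭-sym vs↭ws) (here refl)
...     | here y≡x = contradiction (sym y≡x) x≢y
...     | there y∈vs
  -- As `y` itself occurs in `vs`, some letter lies in `(x , y]`. Index 0 selects the first one, so
  -- that no letter of `ms` lies in that interval.
  with split-count (within? (suc x) y) 0 vs (filter-some (within? (suc x) y) (lose y∈vs (x<y , ≤-refl)))
...       | ms , b , ss , refl , (x<b , b≤y) , first =
  exchange [] ms x<b ◅ descend fuel′ ws
    (≤-trans y≤ (≤-trans (≤-reflexive (+-suc x fuel′)) (+-monoˡ-≤ fuel′ x<b)))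
    (↭-trans (swap-ends b x ms) vs↭ws) (exchange-tableau x<b b≤y first tab)

-- From exchanges in words to the Bruhat order

update-tabulate : ∀ {n} (f : Fin n → A) ms {z} → tabulate f ≡ ms ++ y ∷ ss →
  ∃[ q ] (f q ≡ y × (∀ {g : Fin n → A} → g q ≡ z → (∀ i → i ≢ q → g i ≡ f i) → tabulate g ≡ ms ++ z ∷ ss))
update-tabulate {n = suc n} f []       eq with ∷-injective eq
... | refl , refl = zero , refl , λ gq g≗f →
  cong₂ _∷_ gq (tabulate-cong λ i → g≗f (suc i) λ ())
update-tabulate {n = suc n} f (m ∷ ms) eq with ∷-injective eq
... | refl , eq′ with update-tabulate (f ∘ suc) ms eq′
...   | q , fq , update = suc q , fq , λ gq g≗f →
  cong₂ _∷_ (g≗f zero λ ()) (update gq λ i i≢q → g≗f (suc i) (i≢q ∘ Fin.suc-injective))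

transpose-zero-suc : ∀ (q : Fin n) → Components.transpose zero (suc q) (suc q) ≡ zero
transpose-zero-suc q rewrite dec-true (q Fin.≟ q) refl = refl

transpose-zero-other : ∀ {i q : Fin n} → i ≢ q → Components.transpose zero (suc q) (suc i) ≡ suc i
transpose-zero-other {i = i} {q} i≢q rewrite dec-false (i Fin.≟ q) i≢q = refl

-- While `ps` is nonempty, the transposition is a lifted one. Once the first position is the head,
-- only one entry of the tail changes, and `update-tabulate` accepts any function that agrees with
-- `f` at the other positions.
transpose-tabulate : ∀ {n} (f : Fin n → A) ps → tabulate f ≡ ps ++ x ∷ ms ++ y ∷ ss →
  ∃[ p ] ∃[ q ] (p Fin.< q × f p ≡ x × f q ≡ y ×
    tabulate (f ∘ Components.transpose p q) ≡ ps ++ y ∷ ms ++ x ∷ ss)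
transpose-tabulate {ms = ms} {n = suc n} f [] eq with ∷-injective eq
... | refl , eq′ with update-tabulate (f ∘ suc) ms {z = f zero} eq′
...   | q , refl , update = zero , suc q , s≤s z≤n , refl , refl ,
  cong (f (suc q) ∷_) (update (cong f ((transpose-zero-suc q)))
    λ i i≢q → cong f (transpose-zero-other i≢q))
transpose-tabulate {n = suc n} f (_ ∷ ps) eq with ∷-injective eq
... | refl , eq′ with transpose-tabulate (f ∘ suc) ps eq′
...   | p , q , p<q , fp , fq , eq″ = suc p , suc q , s≤s p<q , fp , fq ,
  cong (f zero ∷_) (≡.trans (tabulate-cong (cong f ∘ lift₀-transpose p q ∘ suc)) eq″)

exchange⇒⟶ : ∀ (u : 𝔖 n) {vs ws} → word u ≡ vs → Exchange vs ws → ∃[ u′ ] (u ⟶ u′ × word u′ ≡ ws)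
exchange⇒⟶ u eq (exchange ps ms x<y) with transpose-tabulate (letter u) ps eq
... | p , q , p<q , refl , refl , eq′ = transpose p q ∘ₚ u , (p , q , p<q , x<y , λ _ → refl) , eq′

word-injective : ∀ (v w : 𝔖 n) → word v ≡ word w → v ≈ w
word-injective v w eq i = toℕ-injective (suc-injective (tabulate-injective eq i))
  where
  tabulate-injective : ∀ {n} {f g : Fin n → ℕ} → tabulate f ≡ tabulate g → f ≗ g
  tabulate-injective eq zero    = ∷-injectiveˡ eq
  tabulate-injective eq (suc i) = tabulate-injective (∷-injectiveʳ eq) i

exchanges⇒≤B : ∀ (v w : 𝔖 n) {vs} → word v ≡ vs → Star Exchange vs (word w) → v ≤B w
exchanges⇒≤B v w eq ε        = inj₁ (word-injective v w eq) ◅ ε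
exchanges⇒≤B v w eq (e ◅ es) with exchange⇒⟶ v eq e
... | u , v⟶u , eq′ = inj₂ v⟶u ◅ exchanges⇒≤B u w eq′ es

-- When all letters lie in `1, …, n`, counting over the whole interval gives the length, and
-- counting over `[q , n]` gives the letters that are at least `q`. The threshold 0 lies below the
-- interval and is compared by length alone.
dominated⇒tableau : ∀ {vs ws} → All (Within 1 n) vs → All (Within 1 n) ws →
  Dominated 1 n vs ws → Tableau vs ws
dominated⇒tableau vs-in ws-in dom .#≥-mono xs ys xs′ ys′ refl refl len zero = begin
  #≥ 0 xs     ≤⟨ length-filter (0 ≤?_) xs ⟩
  length xs   ≡⟨ len ⟩
  length xs′  ≡⟨ cong length (filter-all (0 ≤?_) (All.universal (λ _ → z≤n) xs′)) ⟨
  #≥ 0 xs′    ∎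
  where open ≤-Reasoning
dominated⇒tableau {n} vs-in ws-in dom .#≥-mono xs ys xs′ ys′ refl refl len (suc q) = begin
  #≥ (suc q) xs      ≤⟨ count-mono (suc q ≤?_) (within? (suc q) n) (All.map bounded xs-in) ⟩
  #[ suc q , n ] xs   ≤⟨ dom .#-mono xs ys xs′ ys′ refl refl lengths (suc q) (s≤s z≤n) ⟩
  #[ suc q , n ] xs′  ≤⟨ count-mono (within? (suc q) n) (suc q ≤?_) (All.universal (λ _ → proj₁) xs′) ⟩
  #≥ (suc q) xs′     ∎
  where
  open ≤-Reasoning
  xs-in = All.++⁻ˡ xs vs-in
  bounded : ∀ {z} → Within 1 n z → suc q ≤ z → Within (suc q) n z
  bounded (_ , z≤b) q<z = q<z , z≤b
  all-in : ∀ {zs} → All (Within 1 n) zs → #[ 1 , n ] zs ≡ length zs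
  all-in = cong length ∘ filter-all (within? 1 n)
  lengths : #[ 1 , n ] xs ≡ #[ 1 , n ] xs′
  lengths = ≡.trans (all-in xs-in) (≡.trans len (sym (all-in (All.++⁻ˡ xs′ ws-in))))

label : ∀ {k} → 1 ≤ k → k ≤ m → ∃[ i ] ⟦_⟧ {m} i ≡ k
label {k = suc k} _ k<m = fromℕ< k<m , cong suc (toℕ-fromℕ< k<m)

T⇒bruhat : (T : 𝕋 m) (v w : 𝔖 (suc m)) → v ≤[ T ] w → v ≤B w
T⇒bruhat T v w v≤w = exchanges⇒≤B v w refl (tableau⇒exchanges (word w) (word-↭ v w)
  (dominated⇒tableau (All.tabulate (word-bounds v)) (All.tabulate (word-bounds w))
    (spans-dominated #≡ (𝕋-spans T) after)))
  where
  #≡ : ∀ a b → #[ a , b ] (word v) ≡ #[ a , b ] (word w)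
  #≡ a b = count-↭ (within? a b) (word-↭ v w)
  after : ∀ {a k b} → Split (𝕋-spans T) a k b → AfterMono (word v) (word w) a k b
  after {a} {k} {b} sp {p} {q} p< aft with split-bounds sp
  -- The label `k` is a number and has to be presented as a node index; the substitutions pass
  -- between `suc k` and the `k + 1` in the definition of `I`.
  ... | 1≤a , a≤k , k<b , b≤n with label (≤-trans 1≤a a≤k) (≤-pred (≤-trans k<b b≤n))
  ... | i , refl = subst (λ l → After (within? a k) (within? l b) (word w) p q) (+-comm k 1)
    (split-after T {v = v} {w = w} v≤w sp p<
      (subst (λ l → After (within? a k) (within? l b) (word v) p q) (+-comm 1 k) aft))

proposition3p9 : ∀ (m : ℕ) (T : 𝕋 m) (v w : 𝔖 (suc m)) →
    (v ≤R w → v ≤[ T ] w) × (v ≤[ T ] w → v ≤B w)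
proposition3p9 m T v w = weak⇒T T v w , T⇒bruhat T v w
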